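{- The proof system $\mathbf{SC}_{\min}$ is complete with respect to the class of minimal simplicial models, and the proof system $\mathbf{SC}_{\max}$ is complete with respect to the class of maximal simplicial models: every formula of $\mathcal L_D$ true at every world of every minimal (resp. maximal) simplicial model is provable in $\mathbf{SC}_{\min}$ (resp. $\mathbf{SC}_{\max}$).
   Context: Fix a finite set $A$ of agents and a countable set $\mathsf{AP}$. $\mathcal L_D$: $\varphi::=p\mid\neg\varphi\mid\varphi\wedge\varphi\mid D_B\varphi$, $p\in\mathsf{AP}$, $\emptyset\ne B\subseteq A$; $K_a\varphi:=D_{\{a\}}\varphi$, $\mathsf{dead}(a):=K_a\bot$, $\mathsf{alive}(a):=\neg\mathsf{dead}(a)$, $\mathsf{dead}(B):=\bigwedge_{a\in B}\mathsf{dead}(a)$ (empty conjunction $=\top$), $\mathsf{alive}(B):=\neg D_B\bot$, $\overline B=A\setminus B$. $\mathbf{SC}$: propositional tautologies, modus ponens, necessitation (from $\varphi$ infer $D_B\varphi$), and for non-empty $B,B'$: $D_B(\varphi\Rightarrow\psi)\Rightarrow(D_B\varphi\Rightarrow D_B\psi)$; $\varphi\Rightarrow D_B\neg D_B\neg\varphi$; $D_B\varphi\Rightarrow D_BD_B\varphi$; $D_B\varphi\Rightarrow D_{B'}\varphi$ ($B\subseteq B'$); $\mathsf{alive}(B)\wedge\mathsf{alive}(B')\Rightarrow\mathsf{alive}(B\cup B')$; $\bigvee_{a\in A}\mathsf{alive}(a)$; $\mathsf{alive}(B)\wedge\mathsf{dead}(\overline B)\wedge\varphi\Rightarrow D_B(\mathsf{dead}(\overline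 B)\Rightarrow\varphi)$. $\mathbf{SC}_{\min}$ is $\mathbf{SC}$ plus $\mathsf{alive}(B)\wedge\mathsf{dead}(\overline B)\Rightarrow D_B\mathsf{dead}(\overline B)$ for $B\subsetneq A$; $\mathbf{SC}_{\max}$ is $\mathbf{SC}$ plus $\mathsf{alive}(B)\Rightarrow\neg D_B\neg\mathsf{dead}(\overline B)$ for $B\subsetneq A$. A chromatic simplicial complex is $\langle V,S,\chi\rangle$ with $S$ a family of non-empty subsets of $V$ containing all singletons and closed under non-empty subsets, $\chi:V\to A$ injective on each simplex. A generalized simplicial model is $\mathcal C=\langle V,S,\chi,W,\ell\rangle$ with $\mathrm{Facets}\subseteq W\subseteq S$ and $\ell:W\to\mathcal P(\mathsf{AP})$; minimal if $W$ is the set of facets (maximal simplices), maximal if $W=S$. Satisfaction: $\mathcal C,w\models p$ iff $p\in\ell(w)$; boolean clauses standard; $\mathcal C,w\models D_B\varphi$ iff $\mathcal C,w'\models\varphi$ for all $w'\in W$ with $B\subseteq\chi(w\cap w')$. -}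

module Defs where

open import Data.Nat using (ℕ; zero)
open import Data.Bool using (Bool; true; false; not; _∧_; if_then_else_)
open import Data.Fin using (Fin)
open import Data.Fin.Subset using (Subset; _∈_; Nonempty; ⁅_⁆; ∁; _∪_) renaming (_⊆_ to _⊆ˢ_)
open import Data.Fin.Subset.Properties using (x∈⁅x⁆; p⊆p∪q)
open import Data.Vec using (lookup)
open import Data.List using (List; foldr; allFin)
open import Data.Product using (Σ; ∃; _×_; _,_)
open import Data.Empty using (⊥)
open import Relation.Nullary using (¬_; yes; no)
open import Relation.Binary.PropositionalEquality using (_≡_)
open import Level using (Level) renaming (suc to lsuc; zero to lzero)

-- Language L_D over agents A = Fin n and atoms AP = ℕ.
-- D B φ is only formed for non-empty B (irrelevant non-emptiness proof).

data Form (n : ℕ) : Set where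
  atom : ℕ → Form n
  ¬ᶠ_  : Form n → Form n
  _∧ᶠ_ : Form n → Form n → Form n
  D    : (B : Subset n) → .(Nonempty B) → Form n → Form n

infixr 6 _∧ᶠ_

module _ {n : ℕ} where

  infixr 5 _∨ᶠ_
  infixr 4 _⇒_

  -- fixed falsum / verum (AP is non-empty, atom 0 exists)
  ⊥ᶠ : Form n
  ⊥ᶠ = atom 0 ∧ᶠ ¬ᶠ atom 0

  ⊤ᶠ : Form n
  ⊤ᶠ = ¬ᶠ ⊥ᶠ

  _∨ᶠ_ : Form n → Form n → Form n
  φ ∨ᶠ ψ = ¬ᶠ (¬ᶠ φ ∧ᶠ ¬ᶠ ψ)

  _⇒_ : Form n → Form n → Form n
  φ ⇒ ψ = ¬ᶠ (φ ∧ᶠ ¬ᶠ ψ)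

  K : Fin n → Form n → Form n
  K a φ = D ⁅ a ⁆ (a , x∈⁅x⁆ a) φ

  dead : Fin n → Form n
  dead a = K a ⊥ᶠ

  alive : Fin n → Form n
  alive a = ¬ᶠ dead a

  deadS : Subset n → Form n
  deadS B = foldr (λ a acc → if isIn a then dead a ∧ᶠ acc else acc) ⊤ᶠ (allFin n)
    where
    isIn : Fin n → Bool
    isIn a = lookup B a

  aliveS : (B : Subset n) → .(Nonempty B) → Form n
  aliveS B ne = ¬ᶠ D B ne ⊥ᶠ

  someAlive : Form n
  someAlive = foldr (λ a acc → alive a ∨ᶠ acc) ⊥ᶠ (allFin n)

  evalB : (Form n → Bool) → Form n → Bool
  evalB v (atom i)    = v (atom i)
  evalB v (¬ᶠ φ)      = not (evalB v φ)
  evalB v (φ ∧ᶠ ψ)    = evalB v φ ∧ evalB v ψ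
  evalB v (D B ne φ)  = v (D B ne φ)

  Tautology : Form n → Set
  Tautology φ = ∀ (v : Form n → Bool) → evalB v φ ≡ true

data Variant : Set where
  min max : Variant

data _⊢_ {n : ℕ} (s : Variant) : Form n → Set where
  taut  : ∀ {φ} → Tautology φ → s ⊢ φ
  mp    : ∀ {φ ψ} → s ⊢ (φ ⇒ ψ) → s ⊢ φ → s ⊢ ψ
  nec   : ∀ {φ} B .(ne : Nonempty B) → s ⊢ φ → s ⊢ D B ne φ
  axK   : ∀ B .(ne : Nonempty B) φ ψ →
          s ⊢ (D B ne (φ ⇒ ψ) ⇒ (D B ne φ ⇒ D B ne ψ))
  axB   : ∀ B .(ne : Nonempty B) φ →
          s ⊢ (φ ⇒ D B ne (¬ᶠ D B ne (¬ᶠ φ)))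
  ax4   : ∀ B .(ne : Nonempty B) φ →
          s ⊢ (D B ne φ ⇒ D B ne (D B ne φ))
  axMono : ∀ B B' .(ne : Nonempty B) .(ne' : Nonempty B') φ → B ⊆ˢ B' →
          s ⊢ (D B ne φ ⇒ D B' ne' φ)
  axUnion : ∀ B B' .(ne : Nonempty B) .(ne' : Nonempty B') .(ne∪ : Nonempty (B ∪ B')) →
          s ⊢ (aliveS B ne ∧ᶠ aliveS B' ne' ⇒ aliveS (B ∪ B') ne∪)
  axAlive : s ⊢ someAlive
  axDead : ∀ B .(ne : Nonempty B) φ →
          s ⊢ (aliveS B ne ∧ᶠ deadS (∁ B) ∧ᶠ φ ⇒ D B ne (deadS (∁ B) ⇒ φ))
  axMin : s ≡ min → ∀ B .(ne : Nonempty B) → Nonempty (∁ B) →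
          s ⊢ (aliveS B ne ∧ᶠ deadS (∁ B) ⇒ D B ne (deadS (∁ B)))
  axMax : s ≡ max → ∀ B .(ne : Nonempty B) → Nonempty (∁ B) →
          s ⊢ (aliveS B ne ⇒ ¬ᶠ D B ne (¬ᶠ deadS (∁ B)))

Pred : Set → Set₁
Pred V = V → Set

_⊆_ : ∀ {V : Set} → Pred V → Pred V → Set
X ⊆ Y = ∀ {v} → X v → Y v

_≐_ : ∀ {V : Set} → Pred V → Pred V → Set
X ≐ Y = (X ⊆ Y) × (Y ⊆ X)

NonEmptyP : ∀ {V : Set} → Pred V → Set
NonEmptyP {V} X = Σ V X

record Model (n : ℕ) : Set₁ where
  field
    V   : Set
    χ   : V → Fin n
    S   : Pred V → Set
    S-nonempty  : ∀ X → S X → NonEmptyP X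
    S-singleton : ∀ v → S (λ u → u ≡ v)
    S-down      : ∀ X Y → S X → Y ⊆ X → NonEmptyP Y → S Y
    chromatic   : ∀ X → S X → ∀ u v → X u → X v → χ u ≡ χ v → u ≡ v

  Facet : Pred V → Set₁
  Facet X = S X × (∀ Y → S Y → X ⊆ Y → Y ⊆ X)

  field
    W   : Pred V → Set
    W-resp    : ∀ X Y → X ≐ Y → W X → W Y
    facet⊆W   : ∀ X → Facet X → W X
    W⊆S       : ∀ X → W X → S X
    ℓ   : Pred V → ℕ → Set
    ℓ-resp    : ∀ X Y p → X ≐ Y → ℓ X p → ℓ Y p

open Model public

IsMinimal : ∀ {n} → Model n → Set₁
IsMinimal M = ∀ X → W M X → Facet M X

IsMaximal : ∀ {n} → Model n → Set₁
IsMaximal M = ∀ X → S M X → W M X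

_⊆χ_∩_ : ∀ {n} {M : Model n} → Subset n → Pred (V M) → Pred (V M) → Set
_⊆χ_∩_ {M = M} B w w' = ∀ a → a ∈ B → Σ (V M) λ v → w v × w' v × χ M v ≡ a

_,_⊨_ : ∀ {n} (M : Model n) → Pred (V M) → Form n → Set₁
M , w ⊨ atom p   = Level.Lift _ (ℓ M w p)
M , w ⊨ (¬ᶠ φ)   = ¬ (M , w ⊨ φ)
M , w ⊨ (φ ∧ᶠ ψ) = (M , w ⊨ φ) × (M , w ⊨ ψ)
M , w ⊨ D B _ φ  = ∀ w' → W M w' → _⊆χ_∩_ {M = M} B w w' → M , w' ⊨ φ

ValidMin : ∀ {n} → Form n → Set₁
ValidMin {n} φ = ∀ (M : Model n) → IsMinimal M → ∀ w → W M w → M , w ⊨ φ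

ValidMax : ∀ {n} → Form n → Set₁
ValidMax {n} φ = ∀ (M : Model n) → IsMaximal M → ∀ w → W M w → M , w ⊨ φ

{-# OPTIONS --safe #-}
module Submission where

-- Validity must yield an actual derivation, so instead of maximal consistent sets one
-- starts from all valuations of a finite set Γ of formulas and repeatedly discards those
-- whose characteristic formula is refutable: because a local axiom fails, or because some
-- ¬ D B ψ has no witness among the remaining valuations. If every survivor satisfies φ,
-- the refutations derive φ. Otherwise the survivors form a finite pseudo-model in which
-- D B is interpreted by a partial equivalence R B, monotone in B, and φ fails in it.
-- Unravelling it into a tree of paths, where crossing an edge labelled B keeps exactly the
-- vertices coloured by B, gives a simplicial model: paths sharing their B-vertices are
-- R B-related, since the edges between them all contain B. The formulas added to Γ make
-- axDead determine the atoms at a face with exactly B alive, make axMin force path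
-- simplices to be facets, and make axMax provide a path for every face of a simplex.

open import Defs
open import Data.Bool using (Bool; true; false; not; _∧_; if_then_else_)
import Data.Bool.Properties as Bool
open import Data.Empty using (⊥; ⊥-elim)
open import Data.Fin using (Fin; zero; suc)
open import Data.Fin.Properties using (any?)
open import Data.Fin.Subset using (Subset; Nonempty; ⁅_⁆; ∁; _∪_; inside; outside) renaming (_∈_ to _∈ˢ_; _∉_ to _∉ˢ_; _⊆_ to _⊆ˢ_)
open import Data.Fin.Subset.Properties using (x∈⁅x⁆; x∈⁅y⁆⇒x≡y; nonempty?; p⊆p∪q; q⊆p∪q; x∉p⇒x∈∁p; x∈∁p⇒x∉p) renaming (_∈?_ to _∈ˢ?_; _⊆?_ to _⊆ˢ?_)
open import Data.List using (List; []; _∷_; _++_; map; foldr; filter; concatMap; allFin; length)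
open import Data.List.Membership.Propositional using (_∈_; find; lose)
open import Data.List.Membership.Propositional.Properties using (∈-++⁺ˡ; ∈-++⁺ʳ; ∈-++⁻; ∈-map⁺; ∈-concatMap⁺; ∈-concatMap⁻; ∈-allFin; ∈-filter⁺; ∈-filter⁻)
open import Data.List.Properties using (length-removeAt′)
open import Data.List.Relation.Unary.All as All using (All; []; _∷_)
open import Data.List.Relation.Unary.Any as Any using (Any; here; there)
import Data.List.Relation.Unary.All.Properties as All
import Data.List.Relation.Unary.Any.Properties as Any
open import Data.Nat using (ℕ; zero; suc; _≤_; _<_)
import Data.Nat.Properties as ℕ
open import Data.Product using (Σ; ∃; _×_; _,_; proj₁; proj₂)
open import Data.Sum as Sum using (_⊎_; inj₁; inj₂)
open import Data.Unit using (⊤; tt)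
open import Data.Vec using ([]; _∷_; here; there; lookup; tabulate)
open import Data.Vec.Properties using (lookup⇒[]=; []=⇒lookup; lookup∘tabulate; ≡-dec)
open import Function using (_∘_; case_of_)
open import Level using (lift)
open import Relation.Binary using (DecidableEquality)
open import Relation.Binary.PropositionalEquality using (_≡_; refl; sym; trans; cong; cong₂; subst)
open import Relation.Nullary using (¬_; Dec; yes; no; does; ¬?; _×-dec_; contradiction)
open import Relation.Nullary.Decidable using (recompute; ¬¬-excluded-middle)

private
  variable
    n : ℕ
    s : Variant
    φ ψ γ : Form n

-- Propositional consequence

-- Wrapped in a record because `evalB v φ ≡ true` does not determine `φ`; with the wrapper, formulas
-- are inferred by unification.
record _⊩_ (v : Form n → Bool) (φ : Form n) : Set where
  constructor holds
  field eval : evalB v φ ≡ true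

open _⊩_

infix 4 _⊩_

module _ {v : Form n → Bool} where

  ¬-intro : (v ⊩ φ → ⊥) → v ⊩ ¬ᶠ φ
  ¬-intro {φ = φ} f = holds (go (evalB v φ) refl)
    where
    go : ∀ b → evalB v φ ≡ b → not b ≡ true
    go true  e = ⊥-elim (f (holds e))
    go false e = refl

  ¬-elim : v ⊩ ¬ᶠ φ → ¬ v ⊩ φ
  ¬-elim (holds e) (holds e') rewrite e' = case e of λ ()

  ∧-intro : v ⊩ φ → v ⊩ ψ → v ⊩ φ ∧ᶠ ψ
  ∧-intro (holds e) (holds e') = holds (trans (cong (_∧ _) e) e')

  ∧-elim : v ⊩ φ ∧ᶠ ψ → v ⊩ φ × v ⊩ ψ
  ∧-elim {φ = φ} (holds e) with evalB v φ in eq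
  ... | true  = holds eq , holds e
  ... | false = case e of λ ()

  dichotomy : ∀ φ → v ⊩ φ ⊎ v ⊩ ¬ᶠ φ
  dichotomy φ with evalB v φ in eq
  ... | true  = inj₁ (holds eq)
  ... | false = inj₂ (holds (cong not eq))

  by-contradiction : (v ⊩ ¬ᶠ φ → ⊥) → v ⊩ φ
  by-contradiction {φ = φ} f with dichotomy φ
  ... | inj₁ t = t
  ... | inj₂ t = ⊥-elim (f t)

  ⇒-intro : (v ⊩ φ → v ⊩ ψ) → v ⊩ (φ ⇒ ψ)
  ⇒-intro f = ¬-intro λ t → ¬-elim (proj₂ (∧-elim t)) (f (proj₁ (∧-elim t)))

  ⇒-elim : v ⊩ (φ ⇒ ψ) → v ⊩ φ → v ⊩ ψ
  ⇒-elim t u = by-contradiction λ t' → ¬-elim t (∧-intro u t')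

  ⊥ᶠ-elim : ¬ v ⊩ ⊥ᶠ
  ⊥ᶠ-elim t = ¬-elim (proj₂ (∧-elim t)) (proj₁ (∧-elim t))

  ⊤ᶠ-intro : v ⊩ ⊤ᶠ
  ⊤ᶠ-intro = ¬-intro ⊥ᶠ-elim

  private
    -- Agrees definitionally with the step folded in `deadS`, so that the induction can run over an
    -- arbitrary list instead of `allFin n`.
    deadStep : Subset n → Fin n → Form n → Form n
    deadStep X a acc = if lookup X a then dead a ∧ᶠ acc else acc

    deadFold-elim : ∀ X as → v ⊩ foldr (deadStep X) ⊤ᶠ as →
                    ∀ {a} → a ∈ as → a ∈ˢ X → v ⊩ dead a
    deadFold-elim X (b ∷ as) t (here refl) a∈X rewrite []=⇒lookup a∈X = proj₁ (∧-elim t)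
    deadFold-elim X (b ∷ as) t (there i) a∈X with lookup X b
    ... | true  = deadFold-elim X as (proj₂ (∧-elim t)) i a∈X
    ... | false = deadFold-elim X as t i a∈X

    deadFold-intro : ∀ X as → (∀ a → a ∈ˢ X → v ⊩ dead a) → v ⊩ foldr (deadStep X) ⊤ᶠ as
    deadFold-intro X []       f = ⊤ᶠ-intro
    deadFold-intro X (b ∷ as) f with lookup X b in eq
    ... | true  = ∧-intro (f b (lookup⇒[]= b X eq)) (deadFold-intro X as f)
    ... | false = deadFold-intro X as f

    someAlive-elim′ : ∀ as → v ⊩ foldr (λ a acc → alive a ∨ᶠ acc) ⊥ᶠ as → ∃ λ a → v ⊩ alive a
    someAlive-elim′ []       t = ⊥-elim (⊥ᶠ-elim t)
    someAlive-elim′ (a ∷ as) t with dichotomy (alive a)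
    ... | inj₁ u = a , u
    ... | inj₂ u = someAlive-elim′ as (by-contradiction λ u' → ¬-elim t (∧-intro u u'))

  deadS-elim : ∀ X → v ⊩ deadS X → ∀ {a} → a ∈ˢ X → v ⊩ dead a
  deadS-elim X t {a} = deadFold-elim X (allFin n) t (∈-allFin a)

  deadS-intro : ∀ X → (∀ a → a ∈ˢ X → v ⊩ dead a) → v ⊩ deadS X
  deadS-intro X = deadFold-intro X (allFin n)

  someAlive-elim : v ⊩ someAlive → ∃ λ a → v ⊩ alive a
  someAlive-elim = someAlive-elim′ (allFin n)

-- Currying the premises into nested implications leaves a tautology, from which modus ponens
-- removes them one at a time. Propositional steps in `⊢` can thus be argued semantically.
conseq : ∀ {Θ} → All (s ⊢_) Θ → (∀ v → All (v ⊩_) Θ → v ⊩ φ) → s ⊢ φ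
conseq []       h = taut λ v → eval (h v [])
conseq (p ∷ ps) h = mp (conseq ps λ v ts → ⇒-intro λ t → h v (t ∷ ts)) p

-- Derived modal principles

⁅⁆⊆ : ∀ {a} {B : Subset n} → a ∈ˢ B → ⁅ a ⁆ ⊆ˢ B
⁅⁆⊆ {B = B} a∈B x∈ = subst (_∈ˢ B) (sym (x∈⁅y⁆⇒x≡y _ x∈)) a∈B

module _ {n : ℕ} {s : Variant} where

  ⇒-trans : ∀ {φ ψ χ : Form n} → s ⊢ (φ ⇒ ψ) → s ⊢ (ψ ⇒ χ) → s ⊢ (φ ⇒ χ)
  ⇒-trans p q = conseq (p ∷ q ∷ []) λ { v (t ∷ u ∷ []) → ⇒-intro (⇒-elim u ∘ ⇒-elim t) }

  ¬¬-intro : s ⊢ (φ ⇒ ¬ᶠ ¬ᶠ φ)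
  ¬¬-intro = conseq [] λ _ _ → ⇒-intro λ t → ¬-intro λ u → ¬-elim u t

  module _ (B : Subset n) .(ne : Nonempty B) where

    D-map : s ⊢ (φ ⇒ ψ) → s ⊢ (D B ne φ ⇒ D B ne ψ)
    D-map p = mp (axK B ne _ _) (nec B ne p)

    -- Normality of `D B` for many premises: theorems in `Θ` enter by necessitation, and each boxed
    -- consequence in `Λ` is discharged by one use of `axK`.
    D-conseq : ∀ {Θ Λ} → All (s ⊢_) Θ → All (λ θ → s ⊢ (γ ⇒ D B ne θ)) Λ →
               (∀ v → All (v ⊩_) Θ → All (v ⊩_) Λ → v ⊩ ψ) → s ⊢ (γ ⇒ D B ne ψ)
    D-conseq ps [] h =
      conseq (nec B ne (conseq ps λ v ts → h v ts []) ∷ []) λ { v (t ∷ []) → ⇒-intro λ _ → t }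
    D-conseq ps (q ∷ qs) h =
      conseq (q ∷ D-conseq ps qs (λ v ts us → ⇒-intro λ u → h v ts (u ∷ us)) ∷ axK B ne _ _ ∷ [])
        λ { v (t ∷ t' ∷ k ∷ []) → ⇒-intro λ g → ⇒-elim (⇒-elim k (⇒-elim t' g)) (⇒-elim t g) }

    ax5 : ∀ φ → s ⊢ (¬ᶠ D B ne φ ⇒ D B ne (¬ᶠ D B ne φ))
    ax5 φ = ⇒-trans (axB B ne (¬ᶠ D B ne φ)) (D-map contrapositive)
      where
      contrapositive : s ⊢ (¬ᶠ D B ne (¬ᶠ ¬ᶠ D B ne φ) ⇒ ¬ᶠ D B ne φ)
      contrapositive =
        conseq (ax4 B ne φ ∷ D-map ¬¬-intro ∷ [])
          λ { v (t ∷ u ∷ []) → ⇒-intro λ x → ¬-intro λ y → ¬-elim x (⇒-elim u (⇒-elim t y)) }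

    -- Reflexivity is not an axiom. Given `D B φ` and `¬ φ`, `ax4` boxes `D B φ` while `axB` boxes
    -- its negation, so `D B` holds of falsum, against `B` being alive.
    alive⇒reflexive : ∀ φ → s ⊢ (aliveS B ne ⇒ (D B ne φ ⇒ φ))
    alive⇒reflexive φ =
      conseq (D-conseq {γ = D B ne φ ∧ᶠ ¬ᶠ φ} [] (fromBox ∷ fromFalse ∷ [])
                (λ { v [] (t ∷ u ∷ []) → ⊥-elim (¬-elim u t) }) ∷ [])
        λ { v (t ∷ []) → ⇒-intro λ al → ⇒-intro λ d → by-contradiction λ nφ →
              ¬-elim al (⇒-elim t (∧-intro d nφ)) }
      where
      fromBox : s ⊢ (D B ne φ ∧ᶠ ¬ᶠ φ ⇒ D B ne (D B ne φ))
      fromBox = conseq (ax4 B ne φ ∷ []) λ { v (t ∷ []) → ⇒-intro (⇒-elim t ∘ proj₁ ∘ ∧-elim) }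

      fromFalse : s ⊢ (D B ne φ ∧ᶠ ¬ᶠ φ ⇒ D B ne (¬ᶠ D B ne φ))
      fromFalse =
        conseq (axB B ne (¬ᶠ φ) ∷ D-map (conseq (D-map ¬¬-intro ∷ [])
                  λ { v (t ∷ []) → ⇒-intro λ x → ¬-intro λ y → ¬-elim x (⇒-elim t y) }) ∷ [])
          λ { v (t ∷ u ∷ []) → ⇒-intro (⇒-elim u ∘ ⇒-elim t ∘ proj₂ ∘ ∧-elim) }

  dead⇒D : ∀ {a} B .(ne : Nonempty B) ψ → a ∈ˢ B → s ⊢ (dead a ⇒ D B ne ψ)
  dead⇒D {a} B ne ψ a∈B =
    ⇒-trans (axMono ⁅ a ⁆ B (a , x∈⁅x⁆ a) ne ⊥ᶠ (⁅⁆⊆ a∈B))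
            (D-map B ne (conseq [] λ _ _ → ⇒-intro (⊥-elim ∘ ⊥ᶠ-elim)))

  -- `axUnion` collects the agents of `B` one by one into a set `C`, and `axMono` returns from `C`
  -- to its subset `B`. The collection starts at a singleton because aliveness is expressible for
  -- non-empty sets only.
  aliveS-intro : ∀ {γ} B → (ne : Nonempty B) → (∀ {a} → a ∈ˢ B → s ⊢ (γ ⇒ alive a)) → s ⊢ (γ ⇒ aliveS B ne)
  aliveS-intro {γ} B ne@(b , b∈B) h = shrink (grow (allFin n))
    where
    grow : ∀ as → ∃ λ C → Σ (Nonempty C) λ ne' → s ⊢ (γ ⇒ aliveS C ne') × (∀ {a} → a ∈ as → a ∈ˢ B → a ∈ˢ C)
    grow [] = ⁅ b ⁆ , (b , x∈⁅x⁆ b) , h b∈B , λ ()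
    grow (a ∷ as) with grow as | a ∈ˢ? B
    ... | C , ne' , p , sup | no a∉B =
          C , ne' , p , λ { (here refl) a∈B → contradiction a∈B a∉B ; (there i) → sup i }
    ... | C , ne' , p , sup | yes a∈B = ⁅ a ⁆ ∪ C , ne∪ ,
          conseq (h a∈B ∷ p ∷ axUnion ⁅ a ⁆ C (a , x∈⁅x⁆ a) ne' ne∪ ∷ [])
            (λ { v (t ∷ u ∷ w ∷ []) → ⇒-intro λ g → ⇒-elim w (∧-intro (⇒-elim t g) (⇒-elim u g)) }) ,
          λ { (here refl) _ → p⊆p∪q C (x∈⁅x⁆ a) ; (there i) a∈B → q⊆p∪q ⁅ a ⁆ C (sup i a∈B) }
      where
      ne∪ : Nonempty (⁅ a ⁆ ∪ C)
      ne∪ = a , p⊆p∪q C (x∈⁅x⁆ a)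

    shrink : (∃ λ C → Σ (Nonempty C) λ ne' → s ⊢ (γ ⇒ aliveS C ne') × (∀ {a} → a ∈ allFin n → a ∈ˢ B → a ∈ˢ C)) →
             s ⊢ (γ ⇒ aliveS B ne)
    shrink (C , ne' , p , sup) =
      conseq (p ∷ axMono B C ne ne' ⊥ᶠ (sup (∈-allFin _)) ∷ [])
        λ { v (t ∷ u ∷ []) → ⇒-intro λ g → ¬-intro λ d → ¬-elim (⇒-elim t g) (⇒-elim u d) }

-- Subformulas

-- Only atoms and `D`-formulas are listed, since `evalB` computes the Boolean connectives from them.
sub : Form n → List (Form n)
sub (atom i)   = atom i ∷ []
sub (¬ᶠ φ)     = sub φ
sub (φ ∧ᶠ ψ)   = sub φ ++ sub ψ
sub (D B ne φ) = D B ne φ ∷ sub φ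

sub-trans : ∀ (φ : Form n) {γ δ} → γ ∈ sub φ → δ ∈ sub γ → δ ∈ sub φ
sub-trans (atom i)   (here refl) j = j
sub-trans (¬ᶠ φ)     i j = sub-trans φ i j
sub-trans (φ ∧ᶠ ψ)   i j with ∈-++⁻ (sub φ) i
... | inj₁ i' = ∈-++⁺ˡ (sub-trans φ i' j)
... | inj₂ i' = ∈-++⁺ʳ (sub φ) (sub-trans ψ i' j)
sub-trans (D B ne φ) (here refl) j = j
sub-trans (D B ne φ) (there i)   j = there (sub-trans φ i j)

-- Subsets of agents, decided and under double negation

⊆⊎∃∉ : (B C : Subset n) → B ⊆ˢ C ⊎ ∃ λ a → a ∈ˢ B × a ∉ˢ C
⊆⊎∃∉ B C with any? (λ a → (a ∈ˢ? B) ×-dec ¬? (a ∈ˢ? C))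
... | yes (a , a∈B , a∉C) = inj₂ (a , a∈B , a∉C)
... | no none = inj₁ λ {a} a∈B → case a ∈ˢ? C of λ where
      (yes a∈C) → a∈C
      (no a∉C)  → contradiction (a , a∈B , a∉C) none

-- For an undecidable `P` no such subset can be computed, but excluded middle is available at each
-- of the finitely many agents under double negation.
¬¬-subset : ∀ {m} (P : Fin m → Set) →
            ¬ ¬ ∃ λ (B : Subset m) → ∀ a → (a ∈ˢ B → P a) × (P a → a ∈ˢ B)
¬¬-subset {zero}  P k = k ([] , λ ())
¬¬-subset {suc m} P k = ¬¬-subset (P ∘ suc) λ { (B , h) → ¬¬-excluded-middle λ where
  (yes p) → k (inside ∷ B , λ { zero → (λ _ → p) , (λ _ → here)
                              ; (suc a) → (λ { (there i) → proj₁ (h a) i }) , there ∘ proj₂ (h a) })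
  (no ¬p) → k (outside ∷ B , λ { zero → (λ ()) , (λ p → contradiction p ¬p)
                               ; (suc a) → (λ { (there i) → proj₁ (h a) i }) , there ∘ proj₂ (h a) }) }

-- Unravelling a frame into a simplicial model

-- R B is a partial equivalence relation with domain { w | B ⊆ L w }; it is not
-- assumed to be the intersection of the R ⁅ a ⁆, which only holds after unravelling.
record Frame (φ₀ : Form n) : Set₁ where
  field
    World      : Set
    L          : World → Subset n
    L-nonempty : ∀ w → Nonempty (L w)
    R          : Subset n → World → World → Set
    R-dom      : ∀ {B w w'} → R B w w' → B ⊆ˢ L w
    R-refl     : ∀ {B w} → B ⊆ˢ L w → R B w w
    R-sym      : ∀ {B w w'} → R B w w' → R B w' w
    R-trans    : ∀ {B w w' w''} → R B w w' → R B w' w'' → R B w w''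
    R-mono     : ∀ {B C w w'} → C ⊆ˢ B → R B w w' → R C w w'
    val        : World → Form n → Bool
    box        : ∀ {B} .{ne : Nonempty B} {ψ w w'} → D B ne ψ ∈ sub φ₀ → R B w w' →
                 val w ⊩ D B ne ψ → val w' ⊩ ψ
    diamond    : ∀ {B} .{ne : Nonempty B} {ψ w} → D B ne ψ ∈ sub φ₀ →
                 val w ⊩ ¬ᶠ D B ne ψ → ∃ λ w' → R B w w' × val w' ⊩ ¬ᶠ ψ
    exact      : ∀ {γ w w'} → γ ∈ sub φ₀ → R (L w) w w' → L w' ⊆ˢ L w → val w ⊩ γ → val w' ⊩ γ

  Minimal : Set
  Minimal = ∀ w w' → R (L w) w w' → L w' ⊆ˢ L w

  Maximal : Set
  Maximal = ∀ B w → Nonempty B → B ⊆ˢ L w → ∃ λ w' → R B w w' × L w' ⊆ˢ B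

module Unravelling {n : ℕ} {φ₀ : Form n} (F : Frame φ₀) (w₀ : Frame.World F) where

  open Frame F

  data Path : Set
  last : Path → World

  data Path where
    root : Path
    step : (p : Path) (B : Subset n) (w : World) → R B (last p) w → Path

  last root           = w₀
  last (step _ _ w _) = w

  Live : Path → Subset n
  Live p = L (last p)

  -- p and step p B w r share their a-coloured vertex exactly when a ∈ B, so this
  -- vertex is represented by the earliest prefix reached along edges containing a.
  rep : Fin n → Path → Path
  rep a root = root
  rep a (step p B w r) with a ∈ˢ? B
  ... | yes _ = rep a p
  ... | no  _ = step p B w r

  IsRep : Fin n → Path → Set
  IsRep a root           = ⊤
  IsRep a (step p B w r) = a ∉ˢ B

  isRep? : ∀ a p → Dec (IsRep a p)
  isRep? a root           = yes tt
  isRep? a (step p B w r) = ¬? (a ∈ˢ? B)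

  rep-∈ : ∀ {a} p {B w r} → a ∈ˢ B → rep a (step p B w r) ≡ rep a p
  rep-∈ {a} p {B} a∈B with a ∈ˢ? B
  ... | yes _  = refl
  ... | no a∉B = contradiction a∈B a∉B

  rep-fixed : ∀ {a} p → IsRep a p → rep a p ≡ p
  rep-fixed root _ = refl
  rep-fixed {a} (step p B w r) a∉B with a ∈ˢ? B
  ... | yes a∈B = contradiction a∈B a∉B
  ... | no _    = refl

  rep-isRep : ∀ a p → IsRep a (rep a p)
  rep-isRep a root = tt
  rep-isRep a (step p B w r) with a ∈ˢ? B
  ... | yes _  = rep-isRep a p
  ... | no a∉B = a∉B

  rep-live : ∀ {a} p → a ∈ˢ Live p → a ∈ˢ Live (rep a p)
  rep-live root a∈ = a∈
  rep-live {a} (step p B w r) a∈ with a ∈ˢ? B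
  ... | yes a∈B = rep-live p (R-dom r a∈B)
  ... | no _    = a∈

  depth : Path → ℕ
  depth root           = 0
  depth (step p _ _ _) = suc (depth p)

  rep-shallow : ∀ a p → rep a p ≡ p ⊎ depth (rep a p) < depth p
  rep-shallow a root = inj₁ refl
  rep-shallow a (step p B w r) with a ∈ˢ? B
  ... | no _  = inj₁ refl
  ... | yes _ with rep-shallow a p
  ...   | inj₁ e rewrite e = inj₂ (ℕ.n<1+n _)
  ...   | inj₂ lt = inj₂ (ℕ.m<n⇒m<1+n lt)

  rep-shallow-≤ : ∀ a p → depth (rep a p) ≤ depth p
  rep-shallow-≤ a p with rep-shallow a p
  ... | inj₁ e  = ℕ.≤-reflexive (cong depth e)
  ... | inj₂ lt = ℕ.<⇒≤ lt

  -- Compare depths. If `rep a q` were shallower than `q`, then `p`, which equals it, would be too;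
  -- but `q` equals `rep b p` and so is no deeper than `p`.
  shared⇒≡ : ∀ {a b} p q → IsRep a p → IsRep b q →
             rep a p ≡ rep a q → rep b p ≡ rep b q → p ≡ q
  shared⇒≡ {a} {b} p q ra rb ea eb with rep-shallow a q
  ... | inj₁ e  = trans (sym (rep-fixed p ra)) (trans ea e)
  ... | inj₂ lt = contradiction
          (ℕ.≤-trans (subst (λ x → depth x ≤ depth p) (trans eb (rep-fixed q rb)) (rep-shallow-≤ b p))
                     (ℕ.≤-reflexive (cong depth (trans (sym (rep-fixed p ra)) ea))))
          (ℕ.<⇒≱ lt)

  shared⇒R : ∀ {B} p q → B ⊆ˢ Live p → B ⊆ˢ Live q →
             (∀ {a} → a ∈ˢ B → rep a p ≡ rep a q) → R B (last p) (last q)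
  shared⇒R root root Bp Bq e = R-refl Bp
  shared⇒R {B} (step p C w r) q Bp Bq e with ⊆⊎∃∉ B C
  ... | inj₁ B⊆C = R-trans (R-sym (R-mono B⊆C r))
                     (shared⇒R p q (R-dom r ∘ B⊆C) Bq λ a∈B → trans (sym (rep-∈ p (B⊆C a∈B))) (e a∈B))
  shared⇒R {B} (step p C w r) root Bp Bq e | inj₂ (a , a∈B , a∉C) =
    case trans (sym (rep-fixed (step p C w r) a∉C)) (e a∈B) of λ ()
  shared⇒R {B} (step p C w r) (step q C' w' r') Bp Bq e | inj₂ (a , a∈B , a∉C) with ⊆⊎∃∉ B C'
  ... | inj₁ B⊆C' = R-trans
          (shared⇒R (step p C w r) q Bp (R-dom r' ∘ B⊆C') λ a∈B → trans (e a∈B) (rep-∈ q (B⊆C' a∈B)))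
          (R-mono B⊆C' r')
  ... | inj₂ (b , b∈B , b∉C') =
          subst (R B w ∘ last) (shared⇒≡ (step p C w r) (step q C' w' r') a∉C b∉C' (e a∈B) (e b∈B)) (R-refl Bp)
  shared⇒R {B} root (step q C' w' r') Bp Bq e with ⊆⊎∃∉ B C'
  ... | inj₁ B⊆C' = R-trans
          (shared⇒R root q Bp (R-dom r' ∘ B⊆C') λ a∈B → trans (e a∈B) (rep-∈ q (B⊆C' a∈B)))
          (R-mono B⊆C' r')
  ... | inj₂ (b , b∈B , b∉C') =
          case trans (e b∈B) (rep-fixed (step q C' w' r') b∉C') of λ ()

  -- The proofs are irrelevant, so a vertex is determined by its colour and position; `recompute`
  -- recovers them from decidability.
  record Vertex : Set where
    constructor vertex
    field
      colour  : Fin n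
      pos     : Path
      .posRep : IsRep colour pos
      .isLive : colour ∈ˢ Live pos

  open Vertex

  vertex-≡ : ∀ {u v} → colour u ≡ colour v → pos u ≡ pos v → u ≡ v
  vertex-≡ refl refl = refl

  record verts (p : Path) (v : Vertex) : Set where
    constructor _,_
    field
      live   : colour v ∈ˢ Live p
      placed : rep (colour v) p ≡ pos v

  open verts

  vertexAt : ∀ p {a} → a ∈ˢ Live p → Vertex
  vertexAt p {a} a∈ = vertex a (rep a p) (rep-isRep a p) (rep-live p a∈)

  vertexAt-∈ : ∀ p {a} (a∈ : a ∈ˢ Live p) → verts p (vertexAt p a∈)
  vertexAt-∈ p a∈ = a∈ , refl

  vertex-∈ : ∀ v → verts (pos v) v
  vertex-∈ (vertex a p posRep isLive) =
    recompute (a ∈ˢ? Live p) isLive , rep-fixed p (recompute (isRep? a p) posRep)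

  Simplex : Pred Vertex → Set
  Simplex X = NonEmptyP X × ∃ λ p → X ⊆ verts p

  verts-nonempty : ∀ p → NonEmptyP (verts p)
  verts-nonempty p = vertexAt p a∈ , vertexAt-∈ p a∈
    where a∈ = proj₂ (L-nonempty (last p))

  verts-simplex : ∀ p → Simplex (verts p)
  verts-simplex p = verts-nonempty p , p , λ x → x

  verts-chromatic : ∀ p {u v} → verts p u → verts p v → colour u ≡ colour v → u ≡ v
  verts-chromatic p (_ , e) (_ , e') c = vertex-≡ c (trans (sym e) (trans (cong (λ a → rep a p) c) e'))

  simplex-chromatic : ∀ X → Simplex X → ∀ u v → X u → X v → colour u ≡ colour v → u ≡ v
  simplex-chromatic X (_ , p , X⊆) u v xu xv = verts-chromatic p (X⊆ xu) (X⊆ xv)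

  ⊆⇒R : ∀ p q → verts p ⊆ verts q → R (Live p) (last p) (last q)
  ⊆⇒R p q p⊆q = shared⇒R p q (λ x → x) (λ a∈ → live (p⊆q (vertexAt-∈ p a∈)))
                  λ a∈ → sym (placed (p⊆q (vertexAt-∈ p a∈)))

  ⊆⇒Live⊆ : ∀ p q → verts p ⊆ verts q → Live p ⊆ˢ Live q
  ⊆⇒Live⊆ p q p⊆q a∈ = live (p⊆q (vertexAt-∈ p a∈))

  IsPath : Pred Vertex → Set
  IsPath X = ∃ λ p → X ≐ verts p

  -- What the truth lemma needs from a choice of worlds, so that the minimal and the maximal model
  -- share one proof.
  record Worlds : Set₁ where
    field
      IsWorld       : Pred Vertex → Set
      respects      : ∀ X Y → X ≐ Y → IsWorld X → IsWorld Y
      world-simplex : ∀ X → IsWorld X → Simplex X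
      verts-world   : ∀ p → IsWorld (verts p)
      facet-world   : ∀ X → Simplex X → (∀ Y → Simplex Y → X ⊆ Y → Y ⊆ X) → IsWorld X
      world-path    : ∀ X → IsWorld X → ¬ ¬ IsPath X

  -- The double negation in ℓ makes satisfaction ¬¬-stable. This is needed in the maximal
  -- case, where a simplex may have an undecidable set of colours and is then only
  -- ¬¬-equal to some verts p.
  module Satisfaction (𝒲 : Worlds) where

    open Worlds 𝒲

    model : Model n
    model = record
      { V = Vertex
      ; χ = colour
      ; S = Simplex
      ; S-nonempty = λ _ → proj₁
      ; S-singleton = λ v → (v , refl) , pos v , λ { refl → vertex-∈ v }
      ; S-down = λ X Y → λ { (_ , p , X⊆) Y⊆X ne → ne , p , λ y → X⊆ (Y⊆X y) }
      ; chromatic = simplex-chromatic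
      ; W = IsWorld
      ; W-resp = respects
      ; facet⊆W = λ { X (sX , mx) → facet-world X sX mx }
      ; W⊆S = world-simplex
      ; ℓ = λ X i → ¬ ¬ ∃ λ p → X ≐ verts p × val (last p) ⊩ atom i
      ; ℓ-resp = λ X Y i → λ { (X⊆Y , Y⊆X) h k → h λ { (p , (X⊆p , p⊆X) , t) →
          k (p , ((λ y → X⊆p (Y⊆X y)) , (λ v → X⊆Y (p⊆X v))) , t) } }
      }

    stable : ∀ ψ X → ¬ ¬ (model , X ⊨ ψ) → model , X ⊨ ψ
    stable (atom i) X h = lift λ k → h λ { (lift t) → t k }
    stable (¬ᶠ ψ)   X h = λ t → h λ nt → nt t
    stable (ψ ∧ᶠ χ) X h = stable ψ X (λ k → h (k ∘ proj₁)) , stable χ X (λ k → h (k ∘ proj₂))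
    stable (D B ne ψ) X h = λ X' wX' sh → stable ψ X' λ k → h λ d → k (d X' wX' sh)

    -- Satisfaction is not decidable, so the positive and the negative half are proved together and
    -- negation swaps them. `X` varies up to `≐` because predicates are not extensional.
    truth : ∀ ψ → (∀ {γ} → γ ∈ sub ψ → γ ∈ sub φ₀) → ∀ p X → X ≐ verts p →
            (val (last p) ⊩ ψ → model , X ⊨ ψ) × (val (last p) ⊩ ¬ᶠ ψ → ¬ (model , X ⊨ ψ))
    truth (atom i) inc p X e@(X⊆p , p⊆X) = (λ t → lift λ k → k (p , e , t)) , λ nt → λ { (lift h) →
      h λ { (q , (X⊆q , q⊆X) , t) →
        -- Different paths may span the same simplex; `exact` makes their last worlds agree on the
        -- atom.
        ¬-elim nt (exact (inc (here refl)) (⊆⇒R q p (λ v → X⊆p (q⊆X v)))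
                     (⊆⇒Live⊆ p q λ v → X⊆q (p⊆X v)) t) } }
    truth (¬ᶠ ψ) inc p X e =
      proj₂ (truth ψ inc p X e) ,
      λ nnt nψ → nψ (proj₁ (truth ψ inc p X e) (by-contradiction (¬-elim nnt)))
    truth (ψ ∧ᶠ χ) inc p X e =
      (λ t → proj₁ ihψ (proj₁ (∧-elim t)) , proj₁ ihχ (proj₂ (∧-elim t))) ,
      λ nt → λ { (tψ , tχ) → ¬-elim nt
        (∧-intro (by-contradiction λ f → proj₂ ihψ f tψ) (by-contradiction λ f → proj₂ ihχ f tχ)) }
      where
      ihψ = truth ψ (inc ∘ ∈-++⁺ˡ) p X e
      ihχ = truth χ (inc ∘ ∈-++⁺ʳ (sub ψ)) p X e
    truth (D B ne ψ) inc p X (X⊆p , p⊆X) = necessarily , possibly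
      where
      necessarily : val (last p) ⊩ D B ne ψ → model , X ⊨ D B ne ψ
      necessarily t X' wX' sh = stable ψ X' λ k → world-path X' wX' λ { (q , X'⊆q , q⊆X') →
        k (proj₁ (truth ψ (inc ∘ there) q X' (X'⊆q , q⊆X'))
            (box (inc (here refl)) (link q X'⊆q) t)) }
        where
        link : ∀ q → X' ⊆ verts q → R B (last p) (last q)
        link q X'⊆q = shared⇒R p q
          (λ a∈ → case sh _ a∈ of λ { (v , x , x' , refl) → live (X⊆p x) })
          (λ a∈ → case sh _ a∈ of λ { (v , x , x' , refl) → live (X'⊆q x') })
          (λ a∈ → case sh _ a∈ of λ { (v , x , x' , refl) → trans (placed (X⊆p x)) (sym (placed (X'⊆q x'))) })

      possibly : val (last p) ⊩ ¬ᶠ D B ne ψ → ¬ (model , X ⊨ D B ne ψ)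
      possibly nt h with diamond (inc (here refl)) nt
      -- The witnessing simplex comes from extending `p` by an edge labelled `B`, which leaves every
      -- vertex with a colour in `B` in place.
      ... | w' , r , nψ = proj₂ (truth ψ (inc ∘ there) p' (verts p') ((λ x → x) , (λ x → x))) nψ
              (h (verts p') (verts-world p') λ a a∈B →
                vertexAt p (R-dom r a∈B) , p⊆X (vertexAt-∈ p (R-dom r a∈B)) ,
                (R-dom (R-sym r) a∈B , rep-∈ p a∈B) , refl)
        where
        p' : Path
        p' = step p B w' r

    refuted : val w₀ ⊩ ¬ᶠ φ₀ → ¬ (∀ X → IsWorld X → model , X ⊨ φ₀)
    refuted t h = proj₂ (truth φ₀ (λ i → i) root (verts root) ((λ x → x) , (λ x → x))) t
                    (h (verts root) (verts-world root))

  -- Countermodels with facets as worlds and with all simplices as worlds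

  minimal-refutes : Minimal → val w₀ ⊩ ¬ᶠ φ₀ → ¬ ValidMin φ₀
  minimal-refutes min-F t valid = refuted t (valid model isMinimal)
    where
    IsPath-simplex : ∀ X → IsPath X → Simplex X
    IsPath-simplex X (p , X⊆p , p⊆X) =
      (proj₁ (verts-nonempty p) , p⊆X (proj₂ (verts-nonempty p))) , p , X⊆p

    pathWorlds : Worlds
    pathWorlds = record
      { IsWorld       = IsPath
      ; respects      = λ { X Y (X⊆Y , Y⊆X) (p , X⊆p , p⊆X) →
                            p , (λ y → X⊆p (Y⊆X y)) , (λ v → X⊆Y (p⊆X v)) }
      ; world-simplex = IsPath-simplex
      ; verts-world   = λ p → p , (λ x → x) , (λ x → x)
      ; facet-world   = λ { X (_ , p , X⊆p) mx → p , X⊆p , mx (verts p) (verts-simplex p) X⊆p }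
      ; world-path    = λ X pX k → k pX
      }

    open Satisfaction pathWorlds

    isMinimal : IsMinimal model
    -- If the simplex of `q` contains that of `p`, their last worlds are `R (Live p)`-related, so
    -- minimality of the frame leaves `q` no further live colour; chromaticity then identifies the
    -- vertices.
    isMinimal X pX@(p , X⊆p , p⊆X) = IsPath-simplex X pX , λ { Y (_ , q , Y⊆q) X⊆Y {v} y →
      let p⊆q : verts p ⊆ verts q
          p⊆q u = Y⊆q (X⊆Y (p⊆X u))
          v-live : colour v ∈ˢ Live p
          v-live = min-F (last p) (last q) (⊆⇒R p q p⊆q) (live (Y⊆q y))
      in subst X (verts-chromatic q (p⊆q (vertexAt-∈ p v-live)) (Y⊆q y) refl)
           (p⊆X (vertexAt-∈ p v-live)) }

  maximal-refutes : Maximal → val w₀ ⊩ ¬ᶠ φ₀ → ¬ ValidMax φ₀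
  maximal-refutes max-F t valid = refuted t (valid model λ _ sX → sX)
    where
    -- Let `B` be the colours of `X`, a face of the simplex of `p`. The frame supplies a world
    -- related by `R B` with exactly `B` alive, and the edge to it cuts the simplex of `p` down to
    -- `X`.
    simplex-path : ∀ X → Simplex X → ¬ ¬ IsPath X
    simplex-path X ((x , xX) , p , X⊆p) k =
      ¬¬-subset (λ a → Σ Vertex λ v → X v × colour v ≡ a) λ { (B , B-colours) →
        let B⊆ : B ⊆ˢ Live p
            B⊆ a∈ = case proj₁ (B-colours _) a∈ of λ { (v , xv , refl) → live (X⊆p xv) }
            ∈B : ∀ {v} → X v → colour v ∈ˢ B
            ∈B xv = proj₂ (B-colours _) (_ , xv , refl)
            (w' , r , L⊆B) = max-F B (last p) (colour x , ∈B xX) B⊆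
        in k (step p B w' r ,
              (λ xv → R-dom (R-sym r) (∈B xv) , trans (rep-∈ p (∈B xv)) (placed (X⊆p xv))) ,
              λ { {v} (a∈ , e) → case proj₁ (B-colours (colour v)) (L⊆B a∈) of λ { (u , xu , c) →
                subst X (verts-chromatic p (X⊆p xu) (B⊆ (L⊆B a∈) , trans (sym (rep-∈ p (L⊆B a∈))) e) c) xu } }) }

    allSimplices : Worlds
    allSimplices = record
      { IsWorld       = Simplex
      ; respects      = λ { X Y (X⊆Y , Y⊆X) ((x , xX) , p , X⊆p) → (x , X⊆Y xX) , p , λ y → X⊆p (Y⊆X y) }
      ; world-simplex = λ _ sX → sX
      ; verts-world   = verts-simplex
      ; facet-world   = λ _ sX _ → sX
      ; world-path    = simplex-path
      }

    open Satisfaction allSimplices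

-- Elimination of refutable types

_≟ᶠ_ : DecidableEquality (Form n)
atom i ≟ᶠ atom j with i ℕ.≟ j
... | yes refl = yes refl
... | no i≢j   = no λ { refl → i≢j refl }
atom _ ≟ᶠ (¬ᶠ _)    = no λ ()
atom _ ≟ᶠ (_ ∧ᶠ _)  = no λ ()
atom _ ≟ᶠ D _ _ _   = no λ ()
(¬ᶠ _) ≟ᶠ atom _    = no λ ()
(¬ᶠ φ) ≟ᶠ (¬ᶠ ψ) with φ ≟ᶠ ψ
... | yes refl = yes refl
... | no φ≢ψ   = no λ { refl → φ≢ψ refl }
(¬ᶠ _) ≟ᶠ (_ ∧ᶠ _)  = no λ ()
(¬ᶠ _) ≟ᶠ D _ _ _   = no λ ()
(_ ∧ᶠ _) ≟ᶠ atom _  = no λ ()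
(_ ∧ᶠ _) ≟ᶠ (¬ᶠ _)  = no λ ()
(φ ∧ᶠ χ) ≟ᶠ (ψ ∧ᶠ ξ) with φ ≟ᶠ ψ | χ ≟ᶠ ξ
... | yes refl | yes refl = yes refl
... | no φ≢ψ   | _        = no λ { refl → φ≢ψ refl }
... | _        | no χ≢ξ   = no λ { refl → χ≢ξ refl }
(_ ∧ᶠ _) ≟ᶠ D _ _ _ = no λ ()
D _ _ _ ≟ᶠ atom _   = no λ ()
D _ _ _ ≟ᶠ (¬ᶠ _)   = no λ ()
D _ _ _ ≟ᶠ (_ ∧ᶠ _) = no λ ()
D B _ φ ≟ᶠ D C _ ψ with ≡-dec Bool._≟_ B C | φ ≟ᶠ ψ
... | yes refl | yes refl = yes refl
... | no B≢C   | _        = no λ { refl → B≢C refl }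
... | _        | no φ≢ψ   = no λ { refl → φ≢ψ refl }

-- Enumeration and search in finite lists

subsets : ∀ n → List (Subset n)
subsets zero    = [] ∷ []
subsets (suc n) = map (inside ∷_) (subsets n) ++ map (outside ∷_) (subsets n)

∈-subsets : (B : Subset n) → B ∈ subsets n
∈-subsets []            = here refl
∈-subsets (inside  ∷ B) = ∈-++⁺ˡ (∈-map⁺ _ (∈-subsets B))
∈-subsets (outside ∷ B) = ∈-++⁺ʳ _ (∈-map⁺ _ (∈-subsets B))

module _ {A : Set} where

  sublists : List A → List (List A)
  sublists []       = [] ∷ []
  sublists (x ∷ xs) = map (x ∷_) (sublists xs) ++ sublists xs

  filter-∈-sublists : ∀ {P : A → Set} (P? : ∀ x → Dec (P x)) xs → filter P? xs ∈ sublists xs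
  filter-∈-sublists P? [] = here refl
  filter-∈-sublists P? (x ∷ xs) with does (P? x)
  ... | true  = ∈-++⁺ˡ (∈-map⁺ _ (filter-∈-sublists P? xs))
  ... | false = ∈-++⁺ʳ _ (filter-∈-sublists P? xs)

  ∀∈⊎ : ∀ {P : A → Set} {Q : Set} xs → (∀ x → x ∈ xs → P x ⊎ Q) → (∀ {x} → x ∈ xs → P x) ⊎ Q
  ∀∈⊎ [] h = inj₁ λ ()
  ∀∈⊎ (x ∷ xs) h with h x (here refl) | ∀∈⊎ xs (λ y → h y ∘ there)
  ... | inj₂ q | _      = inj₂ q
  ... | inj₁ _ | inj₂ q = inj₂ q
  ... | inj₁ p | inj₁ f = inj₁ λ { (here refl) → p ; (there i) → f i }

  ∀∈⊎∃ : ∀ {P Q : A → Set} xs → (∀ x → x ∈ xs → P x ⊎ Q x) → (∀ {x} → x ∈ xs → P x) ⊎ Any Q xs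
  ∀∈⊎∃ xs h = ∀∈⊎ xs λ x i → case h x i of λ where
    (inj₁ p) → inj₁ p
    (inj₂ q) → inj₂ (lose i q)

module Elimination {n : ℕ} (s : Variant) (φ₀ : Form n) where

  Valuation : Set
  Valuation = Form n → Bool

  -- The formulas D B _ ensure that the relation R below has the frame properties
  -- expressed by axMax, axMin and axDead respectively.
  faceSeeds : Subset n → List (Form n)
  faceSeeds B with nonempty? B
  ... | no _   = []
  ... | yes ne = D B ne (¬ᶠ deadS (∁ B)) ∷
                 map (λ a → D B ne (dead a)) (allFin n) ++
                 map (λ γ → D B ne (deadS (∁ B) ⇒ γ)) (sub φ₀)

  seeds : List (Form n)
  seeds = φ₀ ∷ map dead (allFin n) ++ concatMap faceSeeds (subsets n)

  abstract

    Γ : List (Form n)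
    Γ = concatMap sub seeds

    seed-closed : ∀ {α} → α ∈ seeds → ∀ {γ} → γ ∈ sub α → γ ∈ Γ
    seed-closed α∈ γ∈ = ∈-concatMap⁺ sub (Any.map (λ { refl → γ∈ }) α∈)

    Γ-closed : ∀ {α} → α ∈ Γ → ∀ {γ} → γ ∈ sub α → γ ∈ Γ
    Γ-closed α∈ γ∈ = ∈-concatMap⁺ sub
      (Any.map (λ {x} α∈x → sub-trans x α∈x γ∈) (∈-concatMap⁻ sub {xs = seeds} α∈))

  -- Weaker than membership in `Γ`: Boolean combinations of members qualify, and their values still
  -- depend only on the values on `Γ`.
  Closed : Form n → Set
  Closed α = ∀ {γ} → γ ∈ sub α → γ ∈ Γ

  Γ-closed-D : ∀ {B χ} .{ne : Nonempty B} → D B ne χ ∈ Γ → Closed χ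
  Γ-closed-D d∈ γ∈ = Γ-closed d∈ (there γ∈)

  φ₀-closed : Closed φ₀
  φ₀-closed = seed-closed (here refl)

  dead∈Γ : ∀ a → dead a ∈ Γ
  dead∈Γ a = seed-closed (there (∈-++⁺ˡ (∈-map⁺ dead (∈-allFin a)))) (here refl)

  face∈Γ : ∀ B {α} → α ∈ faceSeeds B → α ∈ sub α → α ∈ Γ
  face∈Γ B α∈ = seed-closed (there (∈-++⁺ʳ (map dead (allFin n))
    (∈-concatMap⁺ faceSeeds (Any.map (λ { refl → α∈ }) (∈-subsets B)))))

  face-max∈Γ : ∀ B (ne : Nonempty B) → D B ne (¬ᶠ deadS (∁ B)) ∈ Γ
  face-max∈Γ B ne = face∈Γ B seed (here refl)
    where
    seed : D B ne (¬ᶠ deadS (∁ B)) ∈ faceSeeds B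
    seed with nonempty? B
    ... | yes _   = here refl
    ... | no ¬ne = contradiction ne ¬ne

  face-min∈Γ : ∀ B (ne : Nonempty B) a → D B ne (dead a) ∈ Γ
  face-min∈Γ B ne a = face∈Γ B seed (here refl)
    where
    seed : D B ne (dead a) ∈ faceSeeds B
    seed with nonempty? B
    ... | yes ne' = there (∈-++⁺ˡ (∈-map⁺ (λ a → D B ne' (dead a)) (∈-allFin a)))
    ... | no ¬ne = contradiction ne ¬ne

  face-exact∈Γ : ∀ B (ne : Nonempty B) {γ} → γ ∈ sub φ₀ → D B ne (deadS (∁ B) ⇒ γ) ∈ Γ
  face-exact∈Γ B ne {γ} γ∈ = face∈Γ B seed (here refl)
    where
    seed : D B ne (deadS (∁ B) ⇒ γ) ∈ faceSeeds B
    seed with nonempty? B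
    ... | yes ne' = there (∈-++⁺ʳ (map (λ a → D B ne' (dead a)) (allFin n))
                                   (∈-map⁺ (λ γ → D B ne' (deadS (∁ B) ⇒ γ)) γ∈))
    ... | no ¬ne = contradiction ne ¬ne

  -- Agreement on `Γ` and characteristic formulas

  Agree : Valuation → Valuation → Set
  Agree v w = ∀ γ → γ ∈ Γ → evalB v γ ≡ evalB w γ

  agree-sym : ∀ {v w} → Agree v w → Agree w v
  agree-sym e γ i = sym (e γ i)

  eval-local : ∀ {v w : Valuation} α → (∀ {γ} → γ ∈ sub α → evalB v γ ≡ evalB w γ) → evalB v α ≡ evalB w α
  eval-local (atom i)   e = e (here refl)
  eval-local (¬ᶠ α)     e = cong not (eval-local α e)
  eval-local (α ∧ᶠ β)   e = cong₂ _∧_ (eval-local α (e ∘ ∈-++⁺ˡ)) (eval-local β (e ∘ ∈-++⁺ʳ (sub α)))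
  eval-local (D B ne α) e = e (here refl)

  transfer : ∀ {v w α} → Agree v w → Closed α → v ⊩ α → w ⊩ α
  transfer {α = α} e cl (holds t) = holds (trans (sym (eval-local α λ {γ} i → e γ (cl i))) t)

  lit : Valuation → Form n → Form n
  lit w γ = if evalB w γ then γ else ¬ᶠ γ

  lit-sound : ∀ {v} w γ → v ⊩ lit w γ → evalB v γ ≡ evalB w γ
  lit-sound w γ (holds t) with evalB w γ
  ... | true  = t
  ... | false = Bool.not-injective t

  lit-complete : ∀ {v} w γ → evalB v γ ≡ evalB w γ → v ⊩ lit w γ
  lit-complete w γ e with evalB w γ
  ... | true  = holds e
  ... | false = holds (cong not e)

  ⋀ : List (Form n) → Form n
  ⋀ = foldr _∧ᶠ_ ⊤ᶠ

  ⋀lit-sound : ∀ {v} w Δ → v ⊩ ⋀ (map (lit w) Δ) → ∀ {γ} → γ ∈ Δ → evalB v γ ≡ evalB w γ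
  ⋀lit-sound w (γ ∷ Δ) t (here refl) = lit-sound w γ (proj₁ (∧-elim t))
  ⋀lit-sound w (γ ∷ Δ) t (there i)   = ⋀lit-sound w Δ (proj₂ (∧-elim t)) i

  ⋀lit-complete : ∀ {v} w Δ → (∀ {γ} → γ ∈ Δ → evalB v γ ≡ evalB w γ) → v ⊩ ⋀ (map (lit w) Δ)
  ⋀lit-complete w []      e = ⊤ᶠ-intro
  ⋀lit-complete w (γ ∷ Δ) e = ∧-intro (lit-complete w γ (e (here refl))) (⋀lit-complete w Δ (e ∘ there))

  char : Valuation → Form n
  char w = ⋀ (map (lit w) Γ)

  Refuted : Valuation → Set
  Refuted w = s ⊢ (¬ᶠ char w)

  char-conseq : ∀ {w α Θ} → All (s ⊢_) Θ → (∀ v → Agree w v → All (v ⊩_) Θ → v ⊩ α) → s ⊢ (char w ⇒ α)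
  char-conseq {w} ps h =
    conseq ps λ v ts → ⇒-intro λ c → h v (agree-sym λ _ → ⋀lit-sound w Γ c) ts

  char⊢ : ∀ {w α} → Closed α → w ⊩ α → s ⊢ (char w ⇒ α)
  char⊢ cl t = char-conseq [] λ v e _ → transfer e cl t

  refute : ∀ {w α} → s ⊢ (char w ⇒ α) → s ⊢ (char w ⇒ ¬ᶠ α) → Refuted w
  refute p q = conseq (p ∷ q ∷ []) λ { v (t ∷ u ∷ []) → ¬-intro λ c → ¬-elim (⇒-elim u c) (⇒-elim t c) }

  -- If `w` falsifies `α`, its characteristic formula proves `¬ α` as well as `α`. Hence a condition
  -- derivable from that formula either holds at `w` or refutes it.
  decide : ∀ {w α} → Closed α → s ⊢ (char w ⇒ α) → w ⊩ α ⊎ Refuted w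
  decide {α = α} cl p with dichotomy α
  ... | inj₁ t = inj₁ t
  ... | inj₂ f = inj₂ (refute p (char⊢ cl f))

  -- Live agents and the indistinguishability relations

  L : Valuation → Subset n
  L w = tabulate λ a → evalB w (alive a)

  ∈L⇒alive : ∀ {w a} → a ∈ˢ L w → w ⊩ alive a
  ∈L⇒alive {w} {a} i = holds (trans (sym (lookup∘tabulate _ a)) ([]=⇒lookup i))

  alive⇒∈L : ∀ {w a} → w ⊩ alive a → a ∈ˢ L w
  alive⇒∈L {w} {a} (holds t) = lookup⇒[]= a (L w) (trans (lookup∘tabulate _ a) t)

  ∉L⇒dead : ∀ {w a} → a ∉ˢ L w → w ⊩ dead a
  ∉L⇒dead a∉ = by-contradiction (a∉ ∘ alive⇒∈L)

  char⊢alive : ∀ {w B} (ne : Nonempty B) → B ⊆ˢ L w → s ⊢ (char w ⇒ aliveS B ne)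
  char⊢alive ne B⊆ = aliveS-intro _ ne λ {a} a∈B → char⊢ (Γ-closed (dead∈Γ a)) (∈L⇒alive (B⊆ a∈B))

  char⊢dead : ∀ {w} → s ⊢ (char w ⇒ deadS (∁ (L w)))
  char⊢dead {w} = char-conseq [] λ v e _ → deadS-intro (∁ (L w)) λ a a∈ →
    transfer e (Γ-closed (dead∈Γ a)) (∉L⇒dead (x∈∁p⇒x∉p a∈))

  Boxed : Subset n → Form n → Set
  Boxed B (D C _ _) = C ⊆ˢ B
  Boxed B _         = ⊥

  boxed? : ∀ B γ → Dec (Boxed B γ)
  boxed? B (atom _)  = no λ ()
  boxed? B (¬ᶠ _)    = no λ ()
  boxed? B (_ ∧ᶠ _)  = no λ ()
  boxed? B (D C _ _) = C ⊆ˢ? B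

  boxed-mono : ∀ {B C} γ → C ⊆ˢ B → Boxed C γ → Boxed B γ
  boxed-mono (D _ _ _) C⊆B b = λ i → C⊆B (b i)

  boxes : Subset n → List (Form n)
  boxes B = filter (boxed? B) Γ

  ∈-boxes : ∀ {B C χ} .{ne : Nonempty C} → D C ne χ ∈ Γ → C ⊆ˢ B → D C ne χ ∈ boxes B
  ∈-boxes {B} = ∈-filter⁺ (boxed? B)

  boxes-mono : ∀ {B C γ} → C ⊆ˢ B → γ ∈ boxes C → γ ∈ boxes B
  boxes-mono {B} {C} {γ} C⊆B i with ∈-filter⁻ (boxed? C) {xs = Γ} i
  ... | γ∈ , b = ∈-filter⁺ (boxed? B) γ∈ (boxed-mono γ C⊆B b)

  BoxAgree : Subset n → Valuation → Valuation → Set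
  BoxAgree B w w' = All (λ γ → evalB w γ ≡ evalB w' γ) (boxes B)

  -- Equal values on every `D C χ` of `Γ` with `C ⊆ B`, rather than inclusion of boxed formulas:
  -- transitivity is immediate, symmetry needs only `R-cod`, and shrinking `B` weakens the relation.
  record R (B : Subset n) (w w' : Valuation) : Set where
    constructor related
    field
      dom   : B ⊆ˢ L w
      agree : BoxAgree B w w'

  open R

  R-box : ∀ {B C w w' χ} .{ne : Nonempty C} → R B w w' → D C ne χ ∈ Γ → C ⊆ˢ B →
          evalB w (D C ne χ) ≡ evalB w' (D C ne χ)
  R-box (related _ e) d∈ C⊆B = All.lookup e (∈-boxes d∈ C⊆B)

  -- For `a` in `B`, `dead a` is itself one of the boxed formulas on which the two valuations agree.
  R-cod : ∀ {B w w'} → R B w w' → B ⊆ˢ L w'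
  R-cod {B} {w} {w'} r@(related B⊆ _) {a} a∈ = alive⇒∈L {w'}
    (holds (trans (cong not (sym (R-box r (dead∈Γ a) (⁅⁆⊆ a∈)))) (eval (∈L⇒alive {w} (B⊆ a∈)))))

  -- Positive literals are boxed by `ax4` and negative ones by `ax5`, first for `C` and then for the
  -- larger `B` by monotonicity.
  introspection : ∀ {w B} .(ne : Nonempty B) γ → γ ∈ Γ → Boxed B γ → s ⊢ (char w ⇒ D B ne (lit w γ))
  introspection {w} {B} ne γ@(D C neC χ) γ∈ C⊆B with evalB w γ in eq
  ... | true  = ⇒-trans (char⊢ (Γ-closed γ∈) (holds eq))
                  (⇒-trans (ax4 C neC χ) (axMono C B neC ne _ C⊆B))
  ... | false = ⇒-trans (char⊢ (Γ-closed γ∈) (holds (cong not eq)))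
                  (⇒-trans (ax5 C neC χ) (axMono C B neC ne _ C⊆B))

  Reflexive : Valuation → Form n → Set
  Reflexive w (D C ne χ) = C ⊆ˢ L w → w ⊩ D C ne χ → w ⊩ χ
  Reflexive w _          = ⊤

  Witnessed : List Valuation → Valuation → Form n → Set
  Witnessed xs w (D B ne ψ) = w ⊩ ¬ᶠ D B ne ψ → Any (λ w' → R B w w' × w' ⊩ ¬ᶠ ψ) xs
  Witnessed xs w _          = ⊤

  -- Only `witnessed` mentions `xs`, so it is the only condition that discarding other valuations
  -- can destroy.
  record Good (xs : List Valuation) (w : Valuation) : Set where
    field
      reflexive : ∀ {γ} → γ ∈ Γ → Reflexive w γ
      witnessed : ∀ {γ} → γ ∈ Γ → Witnessed xs w γ
      nonempty  : Nonempty (L w)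
      exact     : ∀ {γ} → γ ∈ sub φ₀ → w ⊩ γ → w ⊩ D (L w) nonempty (deadS (∁ (L w)) ⇒ γ)
      minimal   : s ≡ min → ∀ {a} → a ∈ allFin n → a ∉ˢ L w → w ⊩ D (L w) nonempty (dead a)
      maximal   : s ≡ max → ∀ {B} → B ∈ subsets n → (ne : Nonempty B) → B ⊆ˢ L w → Nonempty (∁ B) →
                  w ⊩ ¬ᶠ D B ne (¬ᶠ deadS (∁ B))

  module _ (w : Valuation) where

    reflexive? : ∀ γ → γ ∈ Γ → Reflexive w γ ⊎ Refuted w
    reflexive? (atom _)   _  = inj₁ tt
    reflexive? (¬ᶠ _)     _  = inj₁ tt
    reflexive? (_ ∧ᶠ _)   _  = inj₁ tt
    reflexive? (D C ne χ) d∈ with dichotomy {v = w} (D C ne χ) | ⊆⊎∃∉ C (L w)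
    ... | inj₂ f | _ = inj₁ λ _ t → ⊥-elim (¬-elim f t)
    ... | inj₁ _ | inj₂ (a , a∈ , a∉) = inj₁ λ C⊆ _ → contradiction (C⊆ a∈) a∉
    ... | inj₁ t | inj₁ C⊆ = Sum.map₁ (λ u _ _ → u) (decide {α = χ} (Γ-closed-D d∈)
          (conseq (char⊢alive (recompute (nonempty? C) ne) C⊆ ∷ char⊢ (Γ-closed d∈) t ∷ alive⇒reflexive C ne χ ∷ [])
            λ { v (al ∷ d ∷ ax ∷ []) → ⇒-intro λ c → ⇒-elim (⇒-elim ax (⇒-elim al c)) (⇒-elim d c) }))

    nonempty⊎ : Nonempty (L w) ⊎ Refuted w
    nonempty⊎ with nonempty? (L w)
    ... | yes ne = inj₁ ne
    ... | no ¬ne = inj₂ (refute {α = ⊥ᶠ}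
          (char-conseq (axAlive ∷ []) λ { v e (t ∷ []) → case someAlive-elim t of λ { (a , al) →
            contradiction (a , alive⇒∈L (transfer (agree-sym e) (Γ-closed (dead∈Γ a)) al)) ¬ne } })
          (conseq [] λ _ _ → ⇒-intro λ _ → ⊤ᶠ-intro))

    module _ (ne : Nonempty (L w)) where

      exact? : ∀ γ → γ ∈ sub φ₀ → (w ⊩ γ → w ⊩ D (L w) ne (deadS (∁ (L w)) ⇒ γ)) ⊎ Refuted w
      exact? γ γ∈ with dichotomy {v = w} γ
      ... | inj₂ f = inj₁ λ t → ⊥-elim (¬-elim f t)
      ... | inj₁ t = Sum.map₁ (λ u _ → u) (decide (Γ-closed (face-exact∈Γ (L w) ne γ∈))
              (conseq (char⊢alive ne (λ x → x) ∷ char⊢dead ∷ char⊢ (Γ-closed (φ₀-closed γ∈)) t ∷ axDead (L w) ne γ ∷ [])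
                λ { v (al ∷ de ∷ g ∷ ax ∷ []) → ⇒-intro λ c →
                      ⇒-elim ax (∧-intro (⇒-elim al c) (∧-intro (⇒-elim de c) (⇒-elim g c))) }))

      minimal? : s ≡ min → ∀ a → a ∈ allFin n → (a ∉ˢ L w → w ⊩ D (L w) ne (dead a)) ⊎ Refuted w
      minimal? s≡min a _ with a ∈ˢ? L w
      ... | yes a∈ = inj₁ λ a∉ → contradiction a∈ a∉
      ... | no a∉ = Sum.map₁ (λ u _ → u) (decide (Γ-closed (face-min∈Γ (L w) ne a))
              (conseq (char⊢alive ne (λ x → x) ∷ char⊢dead ∷ axMin s≡min (L w) ne (a , x∉p⇒x∈∁p a∉) ∷
                       D-map (L w) ne (conseq [] λ _ _ → ⇒-intro λ t → deadS-elim (∁ (L w)) t (x∉p⇒x∈∁p a∉)) ∷ [])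
                λ { v (al ∷ de ∷ ax ∷ m ∷ []) → ⇒-intro λ c →
                      ⇒-elim m (⇒-elim ax (∧-intro (⇒-elim al c) (⇒-elim de c))) }))

    maximal? : s ≡ max → ∀ B → B ∈ subsets n →
               ((ne : Nonempty B) → B ⊆ˢ L w → Nonempty (∁ B) → w ⊩ ¬ᶠ D B ne (¬ᶠ deadS (∁ B))) ⊎ Refuted w
    maximal? s≡max B _ with nonempty? B | ⊆⊎∃∉ B (L w) | nonempty? (∁ B)
    ... | no ¬ne | _ | _ = inj₁ λ ne → contradiction ne ¬ne
    ... | yes _ | inj₂ (a , a∈ , a∉) | _ = inj₁ λ _ B⊆ → contradiction (B⊆ a∈) a∉
    ... | yes _ | inj₁ _ | no ¬ne = inj₁ λ _ _ ne → contradiction ne ¬ne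
    ... | yes ne | inj₁ B⊆ | yes ne∁ = Sum.map₁ (λ u _ _ _ → u) (decide (Γ-closed (face-max∈Γ B ne))
            (⇒-trans (char⊢alive ne B⊆) (axMax s≡max B ne ne∁)))

  -- The invariant of the elimination: finitely many theorems that propositionally entail the
  -- disjunction of the characteristic formulas of `xs`, expressed through valuations.
  record Covering (xs : List Valuation) : Set where
    field
      theorems : List (Form n)
      proofs   : All (s ⊢_) theorems
      covers   : ∀ v → All (v ⊩_) theorems → Any (Agree v) xs

  module _ {xs : List Valuation} (cov : Covering xs) where

    open Covering cov

    private
      relate : ∀ {w B ψ} → B ⊆ˢ L w → ∀ {w'} → BoxAgree B w w' × evalB w' (¬ᶠ ψ) ≡ true → R B w w' × w' ⊩ ¬ᶠ ψ
      relate B⊆ (e , t) = related B⊆ e , holds t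

    -- When an agent of `B` is dead, `D B ψ` holds trivially. Otherwise, a valuation satisfying the
    -- covering theorems and the boxed literals of `w` agrees with a member of `xs` that is
    -- `R B`-related to `w`; without a witness this member satisfies `ψ`, so `char w` proves
    -- `D B ψ`.
    witnessed? : ∀ w γ → γ ∈ Γ → Witnessed xs w γ ⊎ Refuted w
    witnessed? w (atom _)   _ = inj₁ tt
    witnessed? w (¬ᶠ _)     _ = inj₁ tt
    witnessed? w (_ ∧ᶠ _)   _ = inj₁ tt
    witnessed? w (D B ne ψ) d∈ with dichotomy {v = w} (D B ne ψ) | ⊆⊎∃∉ B (L w)
    ... | inj₁ t | _ = inj₁ λ f → ⊥-elim (¬-elim f t)
    ... | inj₂ f | inj₂ (a , a∈ , a∉) = inj₂ (refute
            (⇒-trans (char⊢ (Γ-closed (dead∈Γ a)) (∉L⇒dead a∉)) (dead⇒D B ne ψ a∈))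
            (char⊢ (Γ-closed d∈) f))
    ... | inj₂ f | inj₁ B⊆ with Any.any? (λ w' → All.all? (λ γ → evalB w γ Bool.≟ evalB w' γ) (boxes B)
                                             ×-dec (evalB w' (¬ᶠ ψ) Bool.≟ true)) xs
    ...   | yes found = inj₁ λ _ → Any.map (relate B⊆) found
    ...   | no ¬found = inj₂ (refute
            (D-conseq B ne proofs introspections known)
            (char⊢ (Γ-closed d∈) f))
      where
      introspections : All (λ θ → s ⊢ (char w ⇒ D B ne θ)) (map (lit w) (boxes B))
      introspections = All.map⁺ (All.tabulate λ {γ} i →
        let (γ∈ , b) = ∈-filter⁻ (boxed? B) {xs = Γ} i in introspection ne γ γ∈ b)

      known : ∀ v → All (v ⊩_) theorems → All (v ⊩_) (map (lit w) (boxes B)) → v ⊩ ψ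
      known v ts ls = by-contradiction λ nψ → ¬found (Any.map (λ {w'} e →
        All.tabulate (λ {γ} i → trans (sym (lit-sound w γ (All.lookup (All.map⁻ ls) i)))
          (e γ (proj₁ (∈-filter⁻ (boxed? B) {xs = Γ} i)))) ,
        eval (transfer {α = ¬ᶠ ψ} e (Γ-closed-D d∈) nψ)) (covers v ts))

    good? : ∀ w → Good xs w ⊎ Refuted w
    good? w with ∀∈⊎ Γ (reflexive? w) | ∀∈⊎ Γ (witnessed? w) | nonempty⊎ w
    ... | inj₂ r | _ | _ = inj₂ r
    ... | inj₁ _ | inj₂ r | _ = inj₂ r
    ... | inj₁ _ | inj₁ _ | inj₂ r = inj₂ r
    ... | inj₁ reflexive | inj₁ witnessed | inj₁ ne with ∀∈⊎ (sub φ₀) (exact? w ne)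
    ...   | inj₂ r = inj₂ r
    ...   | inj₁ exact = good s refl
      where
      good : ∀ s' → s ≡ s' → Good xs w ⊎ Refuted w
      good min s≡min with ∀∈⊎ (allFin n) (minimal? w ne s≡min)
      ... | inj₂ r = inj₂ r
      ... | inj₁ h = inj₁ record
              { reflexive = reflexive ; witnessed = witnessed ; nonempty = ne ; exact = exact
              ; minimal = λ _ → h ; maximal = λ s≡max → case trans (sym s≡min) s≡max of λ () }
      good max s≡max with ∀∈⊎ (subsets n) (maximal? w s≡max)
      ... | inj₂ r = inj₂ r
      ... | inj₁ h = inj₁ record
              { reflexive = reflexive ; witnessed = witnessed ; nonempty = ne ; exact = exact
              ; minimal = λ s≡min → case trans (sym s≡max) s≡min of λ () ; maximal = λ _ → h }

  remove : ∀ {xs} → Covering xs → (i : Any Refuted xs) → Covering (xs Any.─ i)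
  remove {xs} cov i = record
    { theorems = ¬ᶠ char (Any.lookup i) ∷ theorems
    ; proofs   = Any.lookup-result i ∷ proofs
    ; covers   = λ { v (t ∷ ts) → drop i (covers v ts) λ e →
        ¬-elim t (⋀lit-complete (Any.lookup i) Γ (e _)) }
    }
    where
    open Covering cov
    drop : ∀ {v xs} (i : Any Refuted xs) → Any (Agree v) xs → ¬ Agree v (Any.lookup i) → Any (Agree v) (xs Any.─ i)
    drop (here _)  (here e)  ¬e = ⊥-elim (¬e e)
    drop (here _)  (there j) ¬e = j
    drop (there i) (here e)  ¬e = here e
    drop (there i) (there j) ¬e = there (drop i j ¬e)

  Saturated : Set
  Saturated = ∃ λ xs → Covering xs × (∀ {w} → w ∈ xs → Good xs w)

  -- Each removal may deprive other valuations of their witnesses, so all are checked afresh; `m`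
  -- bounds the length, which drops every time.
  saturate : ∀ m xs → length xs ≤ m → Covering xs → Saturated
  saturate m xs le cov with ∀∈⊎∃ xs (λ w _ → good? cov w)
  ... | inj₁ good = xs , cov , good
  saturate zero    []       le cov | inj₂ ()
  saturate (suc m) xs       le cov | inj₂ i = saturate m (xs Any.─ i) (shorter i le) (remove cov i)
    where
    shorter : ∀ {xs} (i : Any Refuted xs) → length xs ≤ suc m → length (xs Any.─ i) ≤ m
    shorter {xs} i le = ℕ.≤-pred (subst (_≤ suc m) (length-removeAt′ xs (Any.index i)) le)

  -- The initial list: all valuations up to agreement on `Γ`

  open import Data.List.Membership.DecPropositional (_≟ᶠ_ {n}) using (_∈?_)

  valuationOf : List (Form n) → Valuation
  valuationOf Δ γ = does (γ ∈? Δ)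

  true? : (v : Valuation) → ∀ γ → Dec (v γ ≡ true)
  true? v γ = v γ Bool.≟ true

  positives : Valuation → List (Form n)
  positives v = filter (true? v) Γ

  positives-raw : ∀ v γ → γ ∈ Γ → v γ ≡ valuationOf (positives v) γ
  positives-raw v γ γ∈ with γ ∈? positives v
  ... | yes i = proj₂ (∈-filter⁻ (true? v) {xs = Γ} i)
  ... | no ¬i = Bool.¬-not λ t → ¬i (∈-filter⁺ (true? v) γ∈ t)

  eval-sub : ∀ {v : Valuation} α {γ} → γ ∈ sub α → evalB v γ ≡ v γ
  eval-sub (atom i)   (here refl) = refl
  eval-sub (¬ᶠ α)     i = eval-sub α i
  eval-sub (α ∧ᶠ β)   i with ∈-++⁻ (sub α) i
  ... | inj₁ j = eval-sub α j
  ... | inj₂ j = eval-sub β j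
  eval-sub (D B ne α) (here refl) = refl
  eval-sub (D B ne α) (there i)   = eval-sub α i

  positives-agree : ∀ v → Agree v (valuationOf (positives v))
  positives-agree v γ γ∈ = eval-local γ λ {δ} δ∈ →
    trans (eval-sub γ δ∈) (trans (positives-raw v δ (Γ-closed γ∈ δ∈)) (sym (eval-sub γ δ∈)))

  initial : Covering (map valuationOf (sublists Γ))
  initial = record
    { theorems = []
    ; proofs   = []
    ; covers   = λ v _ → lose (∈-map⁺ valuationOf (filter-∈-sublists (true? v) Γ)) (positives-agree v)
    }

  -- The frame of surviving valuations

  module _ (sat : Saturated) where

    private
      xs = proj₁ sat
      cov = proj₁ (proj₂ sat)
      good : ∀ {w} → w ∈ xs → Good xs w
      good = proj₂ (proj₂ sat)

    frame : Frame φ₀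
    frame = record
      { World      = ∃ (_∈ xs)
      ; L          = L ∘ proj₁
      ; L-nonempty = λ { (w , i) → Good.nonempty (good i) }
      ; R          = λ B w w' → R B (proj₁ w) (proj₁ w')
      ; R-dom      = dom
      ; R-refl     = λ B⊆ → related B⊆ (All.tabulate λ _ → refl)
      ; R-sym      = λ r → related (R-cod r) (All.map sym (agree r))
      ; R-trans    = λ { (related B⊆ e) (related _ e') → related B⊆ (All.zipWith (λ { (x , y) → trans x y }) (e , e')) }
      ; R-mono     = λ { C⊆B (related B⊆ e) →
          related (λ i → B⊆ (C⊆B i)) (All.tabulate λ i → All.lookup e (boxes-mono C⊆B i)) }
      ; val        = proj₁
      ; box        = λ { {w' = _ , i} d∈ r (holds t) → Good.reflexive (good i) (φ₀-closed d∈) (R-cod r)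
                         (holds (trans (sym (R-box r (φ₀-closed d∈) (λ x → x))) t)) }
      ; diamond    = λ { {w = _ , i} d∈ t → found (Good.witnessed (good i) (φ₀-closed d∈) t) }
      -- The box over `deadS (∁ (L w)) ⇒ γ` passes from `w` to `w'` and is removed by reflexivity
      -- there; `L w' ⊆ L w` supplies the premise.
      ; exact      = λ { {w = w , i} {w' = w' , i'} γ∈ r L⊆ t →
          let d∈ = face-exact∈Γ (L w) (Good.nonempty (good i)) γ∈
              d  = Good.exact (good i) γ∈ t
          in ⇒-elim (Good.reflexive (good i') d∈ (R-cod r) (holds (trans (sym (R-box r d∈ (λ x → x))) (eval d))))
               (deadS-intro (∁ (L w)) λ a a∈ → ∉L⇒dead λ a∈L → x∈∁p⇒x∉p a∈ (L⊆ a∈L)) }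
      }
      where
      found : ∀ {P : Valuation → Set} → Any P xs → ∃ λ (w : ∃ (_∈ xs)) → P (proj₁ w)
      found a = let (w , i , p) = find a in (w , i) , p

    frame-minimal : s ≡ min → Frame.Minimal frame
    frame-minimal s≡min (w , i) (w' , i') r {a} a∈ with a ∈ˢ? L w
    ... | yes a∈L = a∈L
    ... | no a∉L = ⊥-elim (¬-elim (∈L⇒alive a∈)
            (Good.reflexive (good i') d∈ (R-cod r)
              (holds (trans (sym (R-box r d∈ (λ x → x)))
                (eval (Good.minimal (good i) s≡min (∈-allFin a) a∉L))))))
      where d∈ = face-min∈Γ (L w) (Good.nonempty (good i)) a

    frame-maximal : s ≡ max → Frame.Maximal frame
    frame-maximal s≡max B (w , i) ne B⊆ with nonempty? (∁ B)
    -- `axMax` speaks of proper subsets only; when `B` contains all agents, `w` is its own witness.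
    ... | no ¬ne = (w , i) , Frame.R-refl frame {w = w , i} B⊆ , λ {a} _ → case a ∈ˢ? B of λ where
            (yes a∈) → a∈
            (no a∉)  → contradiction (a , x∉p⇒x∈∁p a∉) ¬ne
    ... | yes ne∁ with find (Good.witnessed (good i) (face-max∈Γ B ne)
                               (Good.maximal (good i) s≡max (∈-subsets B) ne B⊆ ne∁))
    ...   | w' , i' , r , nn = (w' , i') , r , λ {a} a∈L → case a ∈ˢ? B of λ where
            (yes a∈) → a∈
            (no a∉)  → ⊥-elim (¬-elim (∈L⇒alive a∈L)
                          (deadS-elim (∁ B) (by-contradiction (¬-elim nn)) (x∉p⇒x∈∁p a∉)))

    complete : (∀ w → ¬ (Frame.val frame w ⊩ ¬ᶠ φ₀)) → s ⊢ φ₀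
    complete h = conseq (Covering.proofs cov) λ v ts →
      let (w , i , e) = find (Covering.covers cov v ts)
      in transfer (agree-sym e) φ₀-closed (by-contradiction (h (w , i)))

  saturated : Saturated
  saturated = saturate _ _ ℕ.≤-refl initial

theorem50 : ∀ {n : ℕ} →
    (∀ (φ : Form n) → ValidMin φ → min ⊢ φ) × (∀ (φ : Form n) → ValidMax φ → max ⊢ φ)
theorem50 = minimal , maximal
  where
  minimal : ∀ {n} (φ : Form n) → ValidMin φ → min ⊢ φ
  minimal φ valid = complete saturated λ w t →
    Unravelling.minimal-refutes (frame saturated) w (frame-minimal saturated refl) t valid
    where
    open Elimination min φ

  maximal : ∀ {n} (φ : Form n) → ValidMax φ → max ⊢ φ
  maximal φ valid = complete saturated λ w t →
    Unravelling.maximal-refutes (frame saturated) w (frame-maximal saturated refl) t valid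
    where
    open Elimination max φ
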